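{- For an integer $k\ge1$, let $n_{2,k}$ be the smallest integer such that $K_n$ is $k$-canceling for all $n\ge n_{2,k}$. Then for all $k\ge5$, \[k+\log_4(k)\le n_{2,k}\le 2k+4.\]
   Context: A signing of a graph $G$ is a map $\sigma:E(G)\to\{\pm1\}$; for a path $P$, $\sigma(P)=\sum_{e\in P}\sigma(e)$. In a graph $H$, $d_\sigma(u,v)=\min_P|\sigma(P)|$ over all $uv$-paths $P$ in $H$ ($\infty$ if none, $0$ if $u=v$), and $W_\sigma(H)=\frac12\sum_{u,v\in V(H)}d_\sigma(u,v)$. $G$ is $k$-canceling if there is a signing $\sigma$ such that $W_\sigma(G-S)=0$ for every $S\subseteq V(G)$ with $|S|<k$ (with $\sigma$ restricted to $G-S$ and distances computed in $G-S$). -}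

module Defs where

open import Data.Nat using (ℕ; zero; suc; _≤_; _<_)
open import Data.Integer using (ℤ; 0ℤ; 1ℤ; -1ℤ) renaming (_+_ to _+ℤ_)
open import Data.Sign using (Sign)
open import Data.Fin using (Fin)
open import Data.Fin.Subset using (Subset; _∉_; ∣_∣)
open import Data.List using (List; []; _∷_)
open import Data.List.Relation.Unary.All using (All)
open import Data.List.Relation.Unary.Unique.Propositional using (Unique)
open import Data.Product using (Σ; _×_; ∃)
open import Relation.Binary.PropositionalEquality using (_≡_)

-- Value of a sign as an integer (+1 or -1).
signValue : Sign → ℤ
signValue Sign.+ = 1ℤ
signValue Sign.- = -1ℤ

-- A signing of the complete graph K_n on vertex set Fin n:
-- a sign for every (unordered) edge {i,j}, i ≠ j, represented by a
-- symmetric function (its values on the diagonal are irrelevant).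
Signing : ℕ → Set
Signing n = Σ (Fin n → Fin n → Sign) (λ σ → ∀ i j → σ i j ≡ σ j i)

-- A path in K_n is given by its start vertex u and the list ys of the
-- remaining vertices (in order).  In K_n any two distinct vertices are
-- adjacent, so a path is exactly a list of pairwise distinct vertices.
endOf : ∀ {n} → Fin n → List (Fin n) → Fin n
endOf x []       = x
endOf x (y ∷ ys) = endOf y ys

-- σ(P) = sum of the edge signs along the path u, ys.
pathSign : ∀ {n} → Signing n → Fin n → List (Fin n) → ℤ
pathSign σ x []       = 0ℤ
pathSign σ x (y ∷ ys) = signValue (Σ.proj₁ σ x y) +ℤ pathSign σ y ys

-- P is a u–v path in K_n − S.
IsPathAvoiding : ∀ {n} → Subset n → Fin n → Fin n → List (Fin n) → Set
IsPathAvoiding S u v ys =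
  Unique (u ∷ ys) × All (λ w → w ∉ S) (u ∷ ys) × endOf u ys ≡ v

-- d_σ(u,v) = 0 in K_n − S: some u–v path P in K_n − S has σ(P) = 0
-- (distances are ≥ 0 or ∞, so the minimum of |σ(P)| is 0 iff this holds).
ZeroDist : ∀ {n} → Signing n → Subset n → Fin n → Fin n → Set
ZeroDist σ S u v = ∃ λ ys → IsPathAvoiding S u v ys × pathSign σ u ys ≡ 0ℤ

-- W_σ(K_n − S) = 0: a sum of non-negative terms (possibly ∞) vanishes
-- iff every term d_σ(u,v), u,v ∈ V(K_n − S), is 0.
WienerZero : ∀ {n} → Signing n → Subset n → Set
WienerZero {n} σ S = ∀ (u v : Fin n) → u ∉ S → v ∉ S → ZeroDist σ S u v

-- K_n is k-canceling.
KCanceling : ℕ → ℕ → Set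
KCanceling n k = ∃ λ (σ : Signing n) → ∀ (S : Subset n) → ∣ S ∣ < k → WienerZero σ S

-- N is a threshold: K_n is k-canceling for all n ≥ N.
IsThreshold : ℕ → ℕ → Set
IsThreshold k N = ∀ n → N ≤ n → KCanceling n k

-- N = n_{2,k}: the smallest threshold.
IsN2 : ℕ → ℕ → Set
IsN2 k N = IsThreshold k N × (∀ M → IsThreshold k M → N ≤ M)

module Submission where

-- Upper bound: split the vertices into two classes of at least k + 2 vertices each and sign an
-- edge + inside a class and − across.  After deleting fewer than k vertices every class still
-- has a vertex outside any two prescribed ones, so vertices on different sides are joined by a
-- path u r v with signs + −, and vertices on the same side by a path u r b b′ v with signs
-- + − + −.
--
-- Lower bound: inside a monochromatic clique every path P has |σ(P)| = |P|, so in a k-canceling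
-- K_n (delete all other vertices) every monochromatic clique with at least two vertices has at
-- most n − k of them.  With r = n − k ≥ 1, the Ramsey bound R(r + 1, r + 1) ≤ 4^r then forces
-- k ≤ 4^r.  K_(k+1) is not k-canceling, so n_(2,k) ≥ k + 2; and being k-canceling is decidable
-- for each n, so the least threshold exists below the threshold 2k + 4.

open import Defs
open import Data.Bool using (true; false; if_then_else_)
open import Data.Empty using (⊥)
open import Data.Fin as Fin using (Fin; zero; suc)
open import Data.Fin.Properties using (any?; all?)
open import Data.Fin.Subset as Subset using (Subset; inside; outside; _∈_; _∉_; ∣_∣; ⁅_⁆; _∪_; ∁)
open import Data.Fin.Subset.Properties
  using (anySubset?; _∈?_; ∣p∣≤n; ∣p∣≤∣x∷p∣; ∣⊥∣≡0; ∣⁅x⁆∣≡1; ∣∁p∣≡n∸∣p∣; p⊆q⇒∣p∣≤∣q∣; p⊂q⇒∣p∣<∣q∣;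
         x∈⁅x⁆; x∈⁅y⁆⇒x≡y; ∉⊥; x∈p∪q⁺; x∈p∪q⁻; q⊆p∪q; x∈p⇒x∉∁p; x∉∁p⇒x∈p; x∈∁p⇒x∉p)
open import Data.Integer as ℤ using (0ℤ; _◃_)
open import Data.Integer.Properties using (abs-cong)
open import Data.List as List using (List; []; _∷_; length; filter; allFin)
open import Data.List.Properties using (length-tabulate)
open import Data.List.Membership.Propositional using () renaming (_∈_ to _∈ˡ_)
open import Data.List.Membership.Propositional.Properties using (∈-filter⁻)
open import Data.List.Relation.Binary.Subset.Propositional using () renaming (_⊆_ to _⊆ˡ_)
open import Data.List.Relation.Unary.All as All using (All; []; _∷_)
open import Data.List.Relation.Unary.Any using (here; there)
open import Data.List.Relation.Unary.AllPairs as AllPairs using (AllPairs; []; _∷_)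
open import Data.List.Relation.Unary.Linked using (Linked; []; [-]; _∷_)
open import Data.List.Relation.Unary.Unique.Propositional using (Unique)
open import Data.List.Relation.Unary.Unique.Propositional.Properties using (allFin⁺; filter⁺)
open import Data.Nat using (ℕ; zero; suc; _+_; _*_; _∸_; _^_; _≤_; _<_; z≤n; s≤s)
open import Data.Nat.Properties
open import Data.Nat.Tactic.RingSolver using (solve-∀)
open import Data.Product using (Σ; ∃; _×_; _,_; proj₁; proj₂)
open import Data.Sign as Sign using (Sign; opposite) renaming (_*_ to _*ₛ_)
open import Data.Sign.Properties using (s≢opposite[s]) renaming (*-comm to *ₛ-comm)
open import Data.Sum using (_⊎_; inj₁; inj₂; [_,_]′)
open import Data.Vec as Vec using (Vec; []; _∷_)
open import Data.Vec.Properties using (lookup∘tabulate; toList∘fromList; []=⇒lookup; lookup⇒[]=)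
open import Function using (_∘_; id)
open import Level using (0ℓ)
open import Relation.Binary.PropositionalEquality
open import Relation.Nullary using (Dec; yes; no; ¬_; contradiction)
open import Relation.Nullary.Decidable using (map′; ¬?; _×-dec_; _→-dec_; _⊎-dec_; decidable-stable)
open import Relation.Unary using (Pred; Decidable)

Searchable : Set → Set₁
Searchable A = ∀ {P : Pred A 0ℓ} → Decidable P → Dec (∃ P)

searchable-Sign : Searchable Sign
searchable-Sign P? = map′ [ (Sign.+ ,_) , (Sign.- ,_) ]′ (λ { (Sign.+ , p) → inj₁ p ; (Sign.- , p) → inj₂ p })
  (P? Sign.+ ⊎-dec P? Sign.-)

searchable-Vec : ∀ {A} → Searchable A → ∀ m → Searchable (Vec A m)
searchable-Vec search zero    P? = map′ ([] ,_) (λ { ([] , p) → p }) (P? [])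
searchable-Vec search (suc m) P? =
  map′ (λ (x , xs , p) → x ∷ xs , p) (λ { (x ∷ xs , p) → x , xs , p })
       (search (λ x → searchable-Vec search m (λ xs → P? (x ∷ xs))))

searchable⇒all? : ∀ {A} → Searchable A → ∀ {P : Pred A 0ℓ} → Decidable P → Dec (∀ x → P x)
searchable⇒all? search P? =
  map′ (λ ∄¬ x → decidable-stable (P? x) (λ ¬p → ∄¬ (x , ¬p))) (λ ∀p (x , ¬p) → ¬p (∀p x))
       (¬? (search (¬? ∘ P?)))

search-bounded-List : ∀ {A} → Searchable A → ∀ B {P : Pred (List A) 0ℓ} → Decidable P →
                      (∀ xs → P xs → length xs < B) → Dec (∃ P)
search-bounded-List search B {P} P? bounded =
  map′ (λ (_ , _ , v , p) → Vec.toList v , p)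
       (λ (xs , p) → length xs , bounded xs p , Vec.fromList xs , subst P (sym (toList∘fromList xs)) p)
       (anyUpTo? (λ l → searchable-Vec search l (P? ∘ Vec.toList)) B)

toSubset : ∀ {n} → List (Fin n) → Subset n
toSubset []       = Subset.⊥
toSubset (x ∷ xs) = ⁅ x ⁆ ∪ toSubset xs

∈-toSubset⁺ : ∀ {n} {x : Fin n} {xs} → x ∈ˡ xs → x ∈ toSubset xs
∈-toSubset⁺ {xs = y ∷ _}  (here refl) = x∈p∪q⁺ (inj₁ (x∈⁅x⁆ y))
∈-toSubset⁺ {xs = y ∷ _}  (there x∈)  = x∈p∪q⁺ {p = ⁅ y ⁆} (inj₂ (∈-toSubset⁺ x∈))

∈-toSubset⁻ : ∀ {n} {x : Fin n} xs → x ∈ toSubset xs → x ∈ˡ xs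
∈-toSubset⁻ []       x∈ = contradiction x∈ ∉⊥
∈-toSubset⁻ (y ∷ xs) x∈ with x∈p∪q⁻ ⁅ y ⁆ (toSubset xs) x∈
... | inj₁ x∈⁅y⁆ = here (x∈⁅y⁆⇒x≡y y x∈⁅y⁆)
... | inj₂ x∈xs  = there (∈-toSubset⁻ xs x∈xs)

length≤∣toSubset∣ : ∀ {n} {xs : List (Fin n)} → Unique xs → length xs ≤ ∣ toSubset xs ∣
length≤∣toSubset∣ []                          = z≤n
length≤∣toSubset∣ {xs = x ∷ xs} (x∉xs ∷ xs!) =
  ≤-trans (s≤s (length≤∣toSubset∣ xs!))
          (p⊂q⇒∣p∣<∣q∣ (q⊆p∪q ⁅ x ⁆ (toSubset xs) , x , x∈p∪q⁺ (inj₁ (x∈⁅x⁆ x)) , x∉))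
  where
  x∉ : x ∉ toSubset xs
  x∉ x∈ = All.lookup x∉xs (∈-toSubset⁻ xs x∈) refl

unique⇒length≤ : ∀ {n} {xs : List (Fin n)} → Unique xs → length xs ≤ n
unique⇒length≤ {xs = xs} xs! = ≤-trans (length≤∣toSubset∣ xs!) (∣p∣≤n (toSubset xs))

Canceling : ∀ {n} → ℕ → Signing n → Set
Canceling {n} k σ = ∀ (S : Subset n) → ∣ S ∣ < k → WienerZero σ S

zeroDist? : ∀ {n} (σ : Signing n) S u v → Dec (ZeroDist σ S u v)
zeroDist? {n} σ S u v = search-bounded-List any? n zeroPath? (λ _ ((path! , _) , _) → unique⇒length≤ path!)
  where
  zeroPath? : Decidable (λ ys → IsPathAvoiding S u v ys × pathSign σ u ys ≡ 0ℤ)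
  zeroPath? ys = (AllPairs.allPairs? (λ x y → ¬? (x Fin.≟ y)) (u ∷ ys)
                   ×-dec All.all? (λ w → ¬? (w ∈? S)) (u ∷ ys)
                   ×-dec endOf u ys Fin.≟ v)
                 ×-dec pathSign σ u ys ℤ.≟ 0ℤ

canceling? : ∀ {n} k (σ : Signing n) → Dec (Canceling k σ)
canceling? k σ = searchable⇒all? anySubset? λ S → ∣ S ∣ <? k →-dec
  all? λ u → all? λ v → ¬? (u ∈? S) →-dec ¬? (v ∈? S) →-dec zeroDist? σ S u v

canceling-cong : ∀ {n k} {σ τ : Signing n} → (∀ i j → proj₁ σ i j ≡ proj₁ τ i j) →
                 Canceling k σ → Canceling k τ
canceling-cong {σ = σ} {τ} σ≗τ cancel S ∣S∣<k u v u∉S v∉S =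
  let (ys , path , σ[ys]≡0) = cancel S ∣S∣<k u v u∉S v∉S
  in  ys , path , trans (sym (pathSign-cong u ys)) σ[ys]≡0
  where
  pathSign-cong : ∀ x ys → pathSign σ x ys ≡ pathSign τ x ys
  pathSign-cong x []       = refl
  pathSign-cong x (y ∷ ys) = cong₂ ℤ._+_ (cong signValue (σ≗τ x y)) (pathSign-cong y ys)

SignTable : ℕ → Set
SignTable n = Vec (Vec Sign n) n

entry : ∀ {n} → SignTable n → Fin n → Fin n → Sign
entry t i j = Vec.lookup (Vec.lookup t i) j

entry-tabulate : ∀ {n} (f : Fin n → Fin n → Sign) i j → entry (Vec.tabulate (Vec.tabulate ∘ f)) i j ≡ f i j
entry-tabulate f i j = trans (cong (λ row → Vec.lookup row j) (lookup∘tabulate (Vec.tabulate ∘ f) i)) (lookup∘tabulate (f i) j)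

kCanceling? : ∀ n k → Dec (KCanceling n k)
kCanceling? n k = map′ (λ (t , symmetric , cancel) → (entry t , symmetric) , cancel) fromSigning
  (searchable-Vec (searchable-Vec searchable-Sign n) n cancelingTable?)
  where
  CancelingTable : SignTable n → Set
  CancelingTable t = Σ (∀ i j → entry t i j ≡ entry t j i) λ symmetric → Canceling k (entry t , symmetric)

  cancelingTable? : Decidable CancelingTable
  cancelingTable? t with all? (λ i → all? λ j → entry t i j Sign.≟ entry t j i)
  ... | no ¬symmetric = no (¬symmetric ∘ proj₁)
  ... | yes symmetric =
    map′ (symmetric ,_) (λ (_ , cancel) → canceling-cong (λ _ _ → refl) cancel) (canceling? k (entry t , symmetric))

  fromSigning : KCanceling n k → ∃ CancelingTable
  fromSigning ((f , f-sym) , cancel) =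
    t , (λ i j → trans (entry-tabulate f i j) (trans (f-sym i j) (sym (entry-tabulate f j i)))) ,
    canceling-cong (λ i j → sym (entry-tabulate f i j)) cancel
    where t = Vec.tabulate (Vec.tabulate ∘ f)

leastThreshold : ∀ k t → IsThreshold k t → ∃ λ N → IsN2 k N × N ≤ t
leastThreshold k zero    threshold = 0 , (threshold , λ _ _ → z≤n) , z≤n
leastThreshold k (suc t) threshold with kCanceling? t k
... | yes canceling =
  let (N , isN2 , N≤t) = leastThreshold k t lowered in N , isN2 , m≤n⇒m≤1+n N≤t
  where
  lowered : IsThreshold k t
  lowered n t≤n with m≤n⇒m<n∨m≡n t≤n
  ... | inj₁ t<n  = threshold n t<n
  ... | inj₂ refl = canceling
... | no ¬canceling = suc t , (threshold , λ M threshold-M → ≰⇒> (¬canceling ∘ threshold-M t)) , ≤-refl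

2q≤1+p+r⇒q≤p⊎q≤r : ∀ {p q r} → 2 * q ≤ suc (p + r) → q ≤ p ⊎ q ≤ r
2q≤1+p+r⇒q≤p⊎q≤r {p} {q} {r} 2q≤1+p+r with q ≤? p | q ≤? r
... | yes q≤p | _       = inj₁ q≤p
... | no _    | yes q≤r = inj₂ q≤r
... | no q≰p  | no q≰r  = contradiction (begin
    suc (suc (p + r)) ≡⟨ cong suc (+-suc p r) ⟨
    suc p + suc r     ≤⟨ +-mono-≤ (≰⇒> q≰p) (≰⇒> q≰r) ⟩
    q + q             ≡⟨ cong (q +_) (+-identityʳ q) ⟨
    2 * q             ≤⟨ 2q≤1+p+r ⟩
    suc (p + r)       ∎) 1+n≰n
  where open ≤-Reasoning

module _ {n} (σ : Signing n) where

  HasSign : Sign → Fin n → Fin n → Set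
  HasSign s x y = proj₁ σ x y ≡ s

  Monochromatic : Sign → List (Fin n) → Set
  Monochromatic s = AllPairs (HasSign s)

  monochromatic-edge : ∀ {s T x y} → Monochromatic s T → x ∈ˡ T → y ∈ˡ T → x ≢ y → HasSign s x y
  monochromatic-edge (_ ∷ _)       (here refl) (here refl) x≢y = contradiction refl x≢y
  monochromatic-edge (sx ∷ _)      (here refl) (there y∈) _    = All.lookup sx y∈
  monochromatic-edge (sy ∷ _)      (there x∈)  (here refl) _   = trans (proj₂ σ _ _) (All.lookup sy x∈)
  monochromatic-edge (_ ∷ mono)    (there x∈)  (there y∈) x≢y  = monochromatic-edge mono x∈ y∈ x≢y

  linked-in-monochromatic : ∀ {s T xs} → Monochromatic s T → Unique xs → All (_∈ˡ T) xs → Linked (HasSign s) xs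
  linked-in-monochromatic mono []                  []              = []
  linked-in-monochromatic mono (_ ∷ [])            (_ ∷ [])        = [-]
  linked-in-monochromatic mono ((x≢y ∷ _) ∷ xs!) (x∈ ∷ y∈ ∷ xs∈) =
    monochromatic-edge mono x∈ y∈ x≢y ∷ linked-in-monochromatic mono xs! (y∈ ∷ xs∈)

  pathSign-linked : ∀ {s x} ys → Linked (HasSign s) (x ∷ ys) → pathSign σ x ys ≡ s ◃ length ys
  pathSign-linked              []       _             = refl
  pathSign-linked {s} {x} (y ∷ ys) (σxy≡s ∷ linked) = begin
    signValue (proj₁ σ x y) ℤ.+ pathSign σ y ys ≡⟨ cong₂ ℤ._+_ (cong signValue σxy≡s) (pathSign-linked ys linked) ⟩
    signValue s ℤ.+ (s ◃ length ys)            ≡⟨ signValue-+-◃ s (length ys) ⟩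
    s ◃ suc (length ys)                        ∎
    where
    open ≡-Reasoning
    signValue-+-◃ : ∀ s m → signValue s ℤ.+ (s ◃ m) ≡ s ◃ suc m
    signValue-+-◃ Sign.+ zero    = refl
    signValue-+-◃ Sign.+ (suc m) = refl
    signValue-+-◃ Sign.- zero    = refl
    signValue-+-◃ Sign.- (suc m) = refl

  pathSign-in-monochromatic : ∀ {s T x ys} → Monochromatic s T → Unique (x ∷ ys) → All (_∈ˡ T) (x ∷ ys) →
                              pathSign σ x ys ≡ s ◃ length ys
  pathSign-in-monochromatic {ys = ys} mono path! path⊆T =
    pathSign-linked ys (linked-in-monochromatic mono path! path⊆T)

  canceling⇒monochromatic-small : ∀ {k s T} → Canceling k σ → Unique T → Monochromatic s T → 2 ≤ length T →
                                  k + length T ≤ n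
  canceling⇒monochromatic-small {T = _ ∷ []} _ _ _ (s≤s ())
  canceling⇒monochromatic-small {k} {s} {T@(u ∷ v ∷ _)} cancel T! mono _ = ≮⇒≥ λ n<k+∣T∣ →
    let (ys , path , σ[ys]≡0) = cancel S (∣S∣<k n<k+∣T∣) u v (∉S (here refl)) (∉S (there (here refl)))
    in  u≢v (zeroPath⇒u≡v ys path σ[ys]≡0)
    where
    S = ∁ (toSubset T)
    u≢v : u ≢ v
    u≢v = All.lookup (AllPairs.head T!) (here refl)
    ∉S : ∀ {x} → x ∈ˡ T → x ∉ S
    ∉S = x∈p⇒x∉∁p ∘ ∈-toSubset⁺
    ∈T : ∀ {x} → x ∉ S → x ∈ˡ T
    ∈T = ∈-toSubset⁻ T ∘ x∉∁p⇒x∈p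

    ∣S∣<k : n < k + length T → ∣ S ∣ < k
    ∣S∣<k n<k+∣T∣ = begin-strict
      ∣ S ∣                ≡⟨ ∣∁p∣≡n∸∣p∣ (toSubset T) ⟩
      n ∸ ∣ toSubset T ∣   ≤⟨ ∸-monoʳ-≤ n (length≤∣toSubset∣ T!) ⟩
      n ∸ length T         <⟨ +-cancelʳ-< (length T) (n ∸ length T) k n∸∣T∣+∣T∣<k+∣T∣ ⟩
      k                    ∎
      where
      open ≤-Reasoning
      n∸∣T∣+∣T∣<k+∣T∣ : n ∸ length T + length T < k + length T
      n∸∣T∣+∣T∣<k+∣T∣ = subst (_< k + length T) (sym (m∸n+n≡m (unique⇒length≤ T!))) n<k+∣T∣

    zeroPath⇒u≡v : ∀ ys → IsPathAvoiding S u v ys → pathSign σ u ys ≡ 0ℤ → u ≡ v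
    zeroPath⇒u≡v []      (_ , _ , u≡v) _ = u≡v
    zeroPath⇒u≡v (_ ∷ _) (path! , path∉S , _) σ[ys]≡0
      -- 0ℤ is + ◃ 0, so the path would have no edges
      with () ← abs-cong {t = Sign.+} {n = 0}
                  (trans (sym (pathSign-in-monochromatic mono path! (All.map ∈T path∉S))) σ[ys]≡0)

  Clique : Sign → ℕ → List (Fin n) → Set
  Clique s c L = ∃ λ T → T ⊆ˡ L × Unique T × Monochromatic s T × length T ≡ c

  neighbours : Sign → Fin n → List (Fin n) → List (Fin n)
  neighbours s x = filter (λ y → proj₁ σ x y Sign.≟ s)

  length-neighbours : ∀ x L → length (neighbours Sign.+ x L) + length (neighbours Sign.- x L) ≡ length L
  length-neighbours x []       = refl
  length-neighbours x (y ∷ L) with proj₁ σ x y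
  ... | Sign.+ = cong suc (length-neighbours x L)
  ... | Sign.- = trans (+-suc _ _) (cong suc (length-neighbours x L))

  ∈-neighbours⁻ : ∀ {s x y} L → y ∈ˡ neighbours s x L → y ∈ˡ L × HasSign s x y
  ∈-neighbours⁻ {s} {x} L = ∈-filter⁻ (λ y → proj₁ σ x y Sign.≟ s) {xs = L}

  singleton-clique : ∀ {s x L} → x ∈ˡ L → Clique s 1 L
  singleton-clique {x = x} x∈L = x ∷ [] , (λ { (here refl) → x∈L }) , [] ∷ [] , [] ∷ [] , refl

  clique-weaken : ∀ {s s′ c x L} → Clique s c (neighbours s′ x L) → Clique s c (x ∷ L)
  clique-weaken {L = L} (T , T⊆ , T! , mono , ∣T∣≡c) =
    T , there ∘ proj₁ ∘ ∈-neighbours⁻ L ∘ T⊆ , T! , mono , ∣T∣≡c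

  clique-extend : ∀ {s c x L} → All (x ≢_) L → Clique s c (neighbours s x L) → Clique s (suc c) (x ∷ L)
  clique-extend {x = x} {L} x∉L (T , T⊆ , T! , mono , ∣T∣≡c) =
    x ∷ T ,
    (λ { (here refl) → here refl ; (there y∈T) → there (proj₁ (∈-neighbours⁻ L (T⊆ y∈T))) }) ,
    All.tabulate (All.lookup x∉L ∘ proj₁ ∘ ∈-neighbours⁻ L ∘ T⊆) ∷ T! ,
    All.tabulate (proj₂ ∘ ∈-neighbours⁻ L ∘ T⊆) ∷ mono ,
    cong suc ∣T∣≡c

  ramsey : ∀ a b L → Unique L → 2 ^ (a + b) ≤ length L → Clique Sign.+ (suc a) L ⊎ Clique Sign.- (suc b) L
  ramsey a       b       []      _ 2^≤0 = contradiction 2^≤0 (<⇒≱ (m^n>0 2 (a + b)))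
  ramsey zero    b       (x ∷ L) _ _    = inj₁ (singleton-clique (here refl))
  ramsey (suc a) zero    (x ∷ L) _ _    = inj₂ (singleton-clique (here refl))
  ramsey (suc a) (suc b) (x ∷ L) (x∉L ∷ L!) 2^≤1+∣L∣ with 2q≤1+p+r⇒q≤p⊎q≤r split-bound
    where
    split-bound : 2 * 2 ^ (a + suc b) ≤ suc (length (neighbours Sign.+ x L) + length (neighbours Sign.- x L))
    split-bound rewrite length-neighbours x L = 2^≤1+∣L∣
  ... | inj₁ 2^≤∣N⁺∣ = [ inj₁ ∘ clique-extend x∉L , inj₂ ∘ clique-weaken ]′
    (ramsey a (suc b) (neighbours Sign.+ x L) (filter⁺ _ L!) 2^≤∣N⁺∣)
  ... | inj₂ 2^≤∣N⁻∣ = [ inj₁ ∘ clique-weaken , inj₂ ∘ clique-extend x∉L ]′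
    (ramsey (suc a) b (neighbours Sign.- x L) (filter⁺ _ L!)
            (subst (λ e → 2 ^ e ≤ length (neighbours Sign.- x L)) (+-suc a b) 2^≤∣N⁻∣))

¬kCanceling-small : ∀ {n k} → 2 ≤ n → n ≤ suc k → ¬ KCanceling n k
¬kCanceling-small {suc zero} (s≤s ()) _
¬kCanceling-small {n@(suc (suc _))} {k} _ n≤1+k (σ , cancel) =
  <⇒≱ (s≤s n≤1+k)
      (subst (_≤ n) (+-comm k 2) (canceling⇒monochromatic-small σ cancel pair! pair-mono (s≤s (s≤s z≤n))))
  where
  pair! : Unique (zero ∷ suc zero ∷ [])
  pair! = ((λ ()) ∷ []) ∷ [] ∷ []
  pair-mono : Monochromatic σ (proj₁ σ zero (suc zero)) (zero ∷ suc zero ∷ [])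
  pair-mono = (refl ∷ []) ∷ [] ∷ []

kCanceling⇒k≤4^[n∸k] : ∀ {n k} → KCanceling n k → k < n → k ≤ 4 ^ (n ∸ k)
kCanceling⇒k≤4^[n∸k] {n} {k} (σ , cancel) k<n = ≮⇒≥ λ 4^r<k →
  [ clique-too-big , clique-too-big ]′ (ramsey σ r r (allFin n) (allFin⁺ n) (2^[r+r]≤n 4^r<k))
  where
  r = n ∸ k

  2^[r+r]≤n : 4 ^ r < k → 2 ^ (r + r) ≤ length (allFin n)
  2^[r+r]≤n 4^r<k = begin
    2 ^ (r + r)        ≡⟨ cong (λ e → 2 ^ (r + e)) (+-identityʳ r) ⟨
    2 ^ (2 * r)        ≡⟨ ^-*-assoc 2 2 r ⟨
    4 ^ r              ≤⟨ <⇒≤ (<-≤-trans 4^r<k (<⇒≤ k<n)) ⟩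
    n                  ≡⟨ length-tabulate id ⟨
    length (allFin n)  ∎
    where open ≤-Reasoning

  clique-too-big : ∀ {s} → Clique σ s (suc r) (allFin n) → ⊥
  clique-too-big (T , _ , T! , mono , ∣T∣≡1+r) = 1+n≰n (begin
    suc n          ≡⟨ cong suc (m+[n∸m]≡n (<⇒≤ k<n)) ⟨
    suc (k + r)    ≡⟨ +-suc k r ⟨
    k + suc r      ≡⟨ cong (k +_) ∣T∣≡1+r ⟨
    k + length T   ≤⟨ canceling⇒monochromatic-small σ cancel T! mono 2≤∣T∣ ⟩
    n              ∎)
    where
    open ≤-Reasoning
    2≤∣T∣ : 2 ≤ length T
    2≤∣T∣ = subst (2 ≤_) (sym ∣T∣≡1+r) (s≤s (m<n⇒0<n∸m k<n))

threshold⇒1+k<N : ∀ {k N} → 1 ≤ k → IsThreshold k N → suc k < N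
threshold⇒1+k<N 1≤k threshold = ≰⇒> λ N≤1+k → ¬kCanceling-small (s≤s 1≤k) ≤-refl (threshold _ N≤1+k)

∣p∪q∣≤∣p∣+∣q∣ : ∀ {n} (p q : Subset n) → ∣ p ∪ q ∣ ≤ ∣ p ∣ + ∣ q ∣
∣p∪q∣≤∣p∣+∣q∣ []            []            = z≤n
∣p∪q∣≤∣p∣+∣q∣ (outside ∷ p) (outside ∷ q) = ∣p∪q∣≤∣p∣+∣q∣ p q
∣p∪q∣≤∣p∣+∣q∣ (outside ∷ p) (inside  ∷ q) = ≤-trans (s≤s (∣p∪q∣≤∣p∣+∣q∣ p q)) (≤-reflexive (sym (+-suc ∣ p ∣ ∣ q ∣)))
∣p∪q∣≤∣p∣+∣q∣ (inside  ∷ p) (x       ∷ q) = s≤s (≤-trans (∣p∪q∣≤∣p∣+∣q∣ p q) (+-monoʳ-≤ ∣ p ∣ (∣p∣≤∣x∷p∣ x q)))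

∣q∣<∣p∣⇒∃∈p∉q : ∀ {n} (p q : Subset n) → ∣ q ∣ < ∣ p ∣ → ∃ λ x → x ∈ p × x ∉ q
∣q∣<∣p∣⇒∃∈p∉q p q ∣q∣<∣p∣ with any? (λ x → x ∈? p ×-dec ¬? (x ∈? q))
... | yes x∈p∖q = x∈p∖q
... | no ∄      = contradiction (p⊆q⇒∣p∣≤∣q∣ p⊆q) (<⇒≱ ∣q∣<∣p∣)
  where
  p⊆q : p Subset.⊆ q
  p⊆q {x} x∈p = decidable-stable (x ∈? q) (λ x∉q → ∄ (x , x∈p , x∉q))

subsetOfSize : ∀ {h n} → h ≤ n → ∃ λ (R : Subset n) → ∣ R ∣ ≡ h
subsetOfSize {n = n} z≤n = Subset.⊥ , ∣⊥∣≡0 n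
subsetOfSize (s≤s h≤n)   = let (R , ∣R∣≡h) = subsetOfSize h≤n in inside ∷ R , cong suc ∣R∣≡h

≢⇒≡opposite : ∀ {s t : Sign} → s ≢ t → t ≡ opposite s
≢⇒≡opposite {Sign.+} {Sign.+} s≢t = contradiction refl s≢t
≢⇒≡opposite {Sign.+} {Sign.-} _   = refl
≢⇒≡opposite {Sign.-} {Sign.+} _   = refl
≢⇒≡opposite {Sign.-} {Sign.-} s≢t = contradiction refl s≢t

alternating₂ : ∀ {s t₁ t₂} → t₁ ≡ s → t₂ ≡ opposite s →
               signValue (s *ₛ t₁) ℤ.+ (signValue (t₁ *ₛ t₂) ℤ.+ 0ℤ) ≡ 0ℤ
alternating₂ {Sign.+} refl refl = refl
alternating₂ {Sign.-} refl refl = refl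

alternating₄ : ∀ {s t₁ t₂ t₃ t₄} → t₁ ≡ s → t₂ ≡ opposite s → t₃ ≡ opposite s → t₄ ≡ s →
               signValue (s *ₛ t₁) ℤ.+ (signValue (t₁ *ₛ t₂) ℤ.+ (signValue (t₂ *ₛ t₃) ℤ.+ (signValue (t₃ *ₛ t₄) ℤ.+ 0ℤ))) ≡ 0ℤ
alternating₄ {Sign.+} refl refl refl refl = refl
alternating₄ {Sign.-} refl refl refl refl = refl

module _ {n} (R : Subset n) where

  side : Fin n → Sign
  side x = if Vec.lookup R x then Sign.+ else Sign.-

  sideClass : Sign → Subset n
  sideClass Sign.+ = R
  sideClass Sign.- = ∁ R

  side-sideClass : ∀ {s x} → x ∈ sideClass s → side x ≡ s
  side-sideClass {Sign.+} x∈R rewrite []=⇒lookup x∈R = refl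
  side-sideClass {Sign.-} {x} x∈∁R with Vec.lookup R x in eq
  ... | true  = contradiction (lookup⇒[]= x R eq) (x∈∁p⇒x∉p x∈∁R)
  ... | false = refl

  differentSides⇒≢ : ∀ {s x y} → side x ≡ s → side y ≡ opposite s → x ≢ y
  differentSides⇒≢ {s} side-x side-y refl = s≢opposite[s] s (trans (sym side-x) side-y)

  bipartitionSigning : Signing n
  bipartitionSigning = (λ x y → side x *ₛ side y) , (λ x y → *ₛ-comm (side x) (side y))

  module _ {k} (∣R∣≥ : k + 2 ≤ ∣ R ∣) (∣∁R∣≥ : k + 2 ≤ ∣ ∁ R ∣) where

    sideClass-large : ∀ s → k + 2 ≤ ∣ sideClass s ∣
    sideClass-large Sign.+ = ∣R∣≥
    sideClass-large Sign.- = ∣∁R∣≥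

    vertexOnSide-avoiding : ∀ {S} → ∣ S ∣ < k → ∀ s a b → ∃ λ x → side x ≡ s × x ∉ S × x ≢ a × x ≢ b
    vertexOnSide-avoiding {S} ∣S∣<k s a b =
      let (x , x∈ , x∉Q) = ∣q∣<∣p∣⇒∃∈p∉q (sideClass s) Q ∣Q∣<
      in  x , side-sideClass x∈ , x∉Q ∘ x∈p∪q⁺ ∘ inj₁ ,
          (λ x≡a → x∉Q (x∈p∪q⁺ {p = S} (inj₂ (x∈p∪q⁺ (inj₁ (x≡y⇒x∈⁅y⁆ x≡a)))))) ,
          (λ x≡b → x∉Q (x∈p∪q⁺ {p = S} (inj₂ (x∈p∪q⁺ {p = ⁅ a ⁆} (inj₂ (x≡y⇒x∈⁅y⁆ x≡b))))))
      where
      x≡y⇒x∈⁅y⁆ : ∀ {x y : Fin n} → x ≡ y → x ∈ ⁅ y ⁆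
      x≡y⇒x∈⁅y⁆ refl = x∈⁅x⁆ _
      Q = S ∪ (⁅ a ⁆ ∪ ⁅ b ⁆)
      ∣Q∣< : ∣ Q ∣ < ∣ sideClass s ∣
      ∣Q∣< = begin-strict
        ∣ Q ∣                       ≤⟨ ∣p∪q∣≤∣p∣+∣q∣ S _ ⟩
        ∣ S ∣ + ∣ ⁅ a ⁆ ∪ ⁅ b ⁆ ∣     ≤⟨ +-monoʳ-≤ ∣ S ∣ (∣p∪q∣≤∣p∣+∣q∣ ⁅ a ⁆ ⁅ b ⁆) ⟩
        ∣ S ∣ + (∣ ⁅ a ⁆ ∣ + ∣ ⁅ b ⁆ ∣) ≡⟨ cong (∣ S ∣ +_) (cong₂ _+_ (∣⁅x⁆∣≡1 a) (∣⁅x⁆∣≡1 b)) ⟩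
        ∣ S ∣ + 2                   <⟨ +-monoˡ-< 2 ∣S∣<k ⟩
        k + 2                       ≤⟨ sideClass-large s ⟩
        ∣ sideClass s ∣             ∎
        where open ≤-Reasoning

    bipartitionSigning-canceling : Canceling k bipartitionSigning
    bipartitionSigning-canceling S ∣S∣<k u v u∉S v∉S with u Fin.≟ v
    ... | yes refl = [] , ((([] ∷ []) , (u∉S ∷ []) , refl) , refl)
    ... | no u≢v with side u Sign.≟ side v
    ...   | no sides≢ =
      let (r , side-r , r∉S , r≢u , r≢v) = vertexOnSide-avoiding ∣S∣<k (side u) u v
      in  r ∷ v ∷ [] ,
          ((((≢-sym r≢u ∷ u≢v ∷ []) ∷ (r≢v ∷ []) ∷ [] ∷ []) , (u∉S ∷ r∉S ∷ v∉S ∷ []) , refl) ,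
          alternating₂ side-r (≢⇒≡opposite sides≢))
    ...   | yes sides≡ =
      let (r  , side-r  , r∉S  , r≢u  , r≢v)  = vertexOnSide-avoiding ∣S∣<k (side u) u v
          (b  , side-b  , b∉S  , b≢u  , b≢v)  = vertexOnSide-avoiding ∣S∣<k (opposite (side u)) u v
          (b′ , side-b′ , b′∉S , b′≢b , b′≢u) = vertexOnSide-avoiding ∣S∣<k (opposite (side u)) b u
          side-v = sym sides≡
      in  r ∷ b ∷ b′ ∷ v ∷ [] ,
          (((≢-sym r≢u ∷ ≢-sym b≢u ∷ ≢-sym b′≢u ∷ u≢v ∷ [])
             ∷ (differentSides⇒≢ side-r side-b ∷ differentSides⇒≢ side-r side-b′ ∷ r≢v ∷ [])
             ∷ (≢-sym b′≢b ∷ b≢v ∷ [])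
             ∷ (≢-sym (differentSides⇒≢ side-v side-b′) ∷ [])
             ∷ [] ∷ []) ,
           (u∉S ∷ r∉S ∷ b∉S ∷ b′∉S ∷ v∉S ∷ []) , refl) ,
          alternating₄ side-r side-b side-b′ side-v

kCanceling-large : ∀ {n k} → 2 * k + 4 ≤ n → KCanceling n k
kCanceling-large {n} {k} 2k+4≤n =
  let (R , ∣R∣≡k+2) = subsetOfSize (m+n≤o⇒m≤o (k + 2) [k+2]+[k+2]≤n)
      [k+2]+∣R∣≤n   = subst (λ h → (k + 2) + h ≤ n) (sym ∣R∣≡k+2) [k+2]+[k+2]≤n
  in  bipartitionSigning R ,
      bipartitionSigning-canceling R (≤-reflexive (sym ∣R∣≡k+2))
        (subst (k + 2 ≤_) (sym (∣∁p∣≡n∸∣p∣ R)) (m+n≤o⇒m≤o∸n (k + 2) [k+2]+∣R∣≤n))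
  where
  2k+4≡[k+2]+[k+2] : ∀ k → 2 * k + 4 ≡ (k + 2) + (k + 2)
  2k+4≡[k+2]+[k+2] = solve-∀
  [k+2]+[k+2]≤n : (k + 2) + (k + 2) ≤ n
  [k+2]+[k+2]≤n = subst (_≤ n) (2k+4≡[k+2]+[k+2] k) 2k+4≤n

proposition6p2 : ∀ (k : ℕ) → 5 ≤ k →
    ∃ λ N → IsN2 k N × (k ≤ N × k ≤ 4 ^ (N ∸ k)) × N ≤ 2 * k + 4
proposition6p2 k 5≤k with leastThreshold k (2 * k + 4) (λ _ → kCanceling-large)
... | N , isN2@(threshold , _) , N≤2k+4 =
  N , isN2 , (<⇒≤ k<N , kCanceling⇒k≤4^[n∸k] (threshold N ≤-refl) k<N) , N≤2k+4
  where
  k<N : k < N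
  k<N = <-trans (n<1+n k) (threshold⇒1+k<N (≤-trans (s≤s z≤n) 5≤k) threshold)
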